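{- Let $a\geq 2$ be an integer and $m\geq 1$. The number of pyramids of size $m$ made of pieces of length $a$ (with bottom piece covering the interval $]0,a[$) equals $\binom{am-1}{m-1}$.
   Context: Fix an integer $a\geq 2$. A piece is an open interval $]s,s+a[$ of the real line with $s\in\mathbb Z$; two pieces are concurrent iff their intervals intersect. A heap (in the sense of Viennot) is a finite configuration obtained by successively dropping pieces vertically towards the horizontal axis: each dropped piece comes to rest either on the axis or on top of the highest previously placed piece whose interval intersects its own; two dropping orders give the same heap iff they produce the same configuration of placed pieces. Equivalently, a heap is the finite poset of placed pieces ordered by the transitive closure of "$\beta$ lies above $\alpha$ and their intervals intersect". A heap is a pyramid if it has a unique bottom (minimal) piece, i.e. exactly one piece rests on the axis. The size $|p|$ of a pyramid $p$ is its number of pieces. When not otherwise specified, a pyramid is assumed to have its bottom piece covering the interval $]0,a[$. -}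

module Defs where

open import Data.Integer.Base as ℤ using (ℤ; +_; 0ℤ; 1ℤ)
import Data.Integer.Properties as ℤ
open import Data.List.Base using (List; []; _∷_; filter; foldr; length; map)
open import Data.List.Membership.Propositional using (_∈_)
open import Data.List.Relation.Binary.Permutation.Propositional using (↭-setoid)
open import Data.Nat.Base as ℕ using (ℕ; suc; _⊔_)
open import Data.Product using (_×_; _,_; ∃; ∃!)
open import Data.Rational.Unnormalised.Base using (ℚᵘ; mkℚᵘ; _<_; _/_; *<*)
import Data.Rational.Unnormalised.Properties as ℚᵘ
open import Data.Sum.Base using (inj₁; inj₂)
open import Level using (0ℓ)
open import Relation.Binary.Bundles using (Setoid)
import Relation.Binary.Construct.On as On
open import Relation.Binary.PropositionalEquality using (_≡_; sym; subst; subst₂)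
open import Relation.Nullary.Decidable using (Dec; map′; _×-dec_)

-- A piece ]s,s+a[ is represented by its left end s.  Open intervals with
-- integer ends meet in ℝ iff they share a rational point, so ℚ stands in for ℝ.

infix 4 _∈]_,_[

_∈]_,_[ : ℚᵘ → ℤ → ℤ → Set
x ∈] l , r [ = (l / 1) < x × x < (r / 1)

Concurrent : ℕ → ℤ → ℤ → Set
Concurrent a s t = ∃ λ x → x ∈] s , s ℤ.+ + a [ × x ∈] t , t ℤ.+ + a [

private
  _+½ : ℤ → ℚᵘ
  v +½ = mkℚᵘ (1ℤ ℤ.+ v ℤ.* + 2) 1

  lower : ∀ {u v} → u ℤ.≤ v → (u / 1) < v +½
  lower {u} {v} u≤v = *<* (subst (u ℤ.* + 2 ℤ.<_) (sym (ℤ.*-identityʳ _))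
    (ℤ.≤-<-trans (ℤ.*-monoʳ-≤-nonNeg (+ 2) u≤v) (ℤ.suc[i]≤j⇒i<j ℤ.≤-refl)))

  upper : ∀ {v w} → v ℤ.< w → v +½ < (w / 1)
  upper {v} {w} v<w = *<* (subst (ℤ._< w ℤ.* + 2) (sym (ℤ.*-identityʳ _))
    (ℤ.<-≤-trans
      (subst (1ℤ ℤ.+ v ℤ.* + 2 ℤ.<_) (sym (ℤ.*-distribʳ-+ (+ 2) 1ℤ v))
        (ℤ.+-monoˡ-< (v ℤ.* + 2) (ℤ.+<+ (ℕ.s≤s (ℕ.s≤s ℕ.z≤n)))))
      (ℤ.*-monoʳ-≤-nonNeg (+ 2) (ℤ.i<j⇒suc[i]≤j v<w))))

  drop-/1 : ∀ {u w} → (u / 1) < (w / 1) → u ℤ.< w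
  drop-/1 {u} {w} (*<* p) = subst₂ ℤ._<_ (ℤ.*-identityʳ u) (ℤ.*-identityʳ w) p

overlap⇒concurrent : ∀ {a s t} → s ℤ.< t ℤ.+ + a × t ℤ.< s ℤ.+ + a → Concurrent a s t
overlap⇒concurrent {a} {s} {t} (s<t+a , t<s+a) with ℤ.≤-total s t
... | inj₁ s≤t = t +½ , (lower s≤t , upper t<s+a)
                      , (lower ℤ.≤-refl , upper (ℤ.<-≤-trans t<s+a (ℤ.+-monoˡ-≤ (+ a) s≤t)))
... | inj₂ t≤s = s +½ , (lower ℤ.≤-refl , upper (ℤ.<-≤-trans s<t+a (ℤ.+-monoˡ-≤ (+ a) t≤s)))
                      , (lower t≤s , upper s<t+a)

concurrent⇒overlap : ∀ {a s t} → Concurrent a s t → s ℤ.< t ℤ.+ + a × t ℤ.< s ℤ.+ + a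
concurrent⇒overlap (x , (s<x , x<s+a) , (t<x , x<t+a)) =
  drop-/1 (ℚᵘ.<-trans s<x x<t+a) , drop-/1 (ℚᵘ.<-trans t<x x<s+a)

concurrent? : ∀ a s t → Dec (Concurrent a s t)
concurrent? a s t = map′ overlap⇒concurrent concurrent⇒overlap
  ((s ℤ.<? t ℤ.+ + a) ×-dec (t ℤ.<? s ℤ.+ + a))

infix 6 _at_

record Placed : Set where
  constructor _at_
  field
    position : ℤ
    level    : ℕ    -- 0 for a piece resting on the axis

open Placed public

restLevel : ℕ → ℤ → List Placed → ℕ
restLevel a s c =
  foldr _⊔_ 0 (map (λ p → suc (level p)) (filter (λ p → concurrent? a s (position p)) c))

dropPiece : ℕ → ℤ → List Placed → List Placed
dropPiece a s c = (s at restLevel a s c) ∷ c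

-- Read from the right: the head of a dropping order is the piece dropped last.
configuration : ℕ → List ℤ → List Placed
configuration a = foldr (dropPiece a) []

-- A heap is a dropping order, with heaps compared by their configurations.
-- Two pieces of a configuration are never equal, so that _↭_ on
-- configurations is equality of the sets of placed pieces.
Heap : ℕ → Setoid 0ℓ 0ℓ
Heap a = On.setoid (↭-setoid {A = Placed}) (configuration a)

IsPyramid : List Placed → Set
IsPyramid c = ∃! _≡_ λ p → p ∈ c × level p ≡ 0

record Pyramid (a m : ℕ) : Set where
  field
    heap      : Setoid.Carrier (Heap a)
    isPyramid : IsPyramid (configuration a heap)
    bottom    : (0ℤ at 0) ∈ configuration a heap
    size      : length (configuration a heap) ≡ m

Pyramids : ℕ → ℕ → Setoid 0ℓ 0ℓ
Pyramids a m = On.setoid (Heap a) (Pyramid.heap {a} {m})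

{-# OPTIONS --safe #-}
module Submission where

-- Put a = b + 1.  Every heap has exactly one dropping order in which no piece
-- starts more than b to the left of the piece dropped just before it.  Such an
-- order cannot jump leftwards over a position without meeting a piece concurrent
-- with it, so it gives a pyramid exactly when no piece starts more than b to the
-- right of all its predecessors.  If the last piece is at distance d from the
-- rightmost one, the next piece therefore has 2b + 1 + d possible positions, after
-- which the distance is k ∸ b for k = 0, …, 2b + d.  The number of ways to
-- drop n more pieces is N(n) + d choose n, where N(n) = n + b(n + 1): the recurrence
-- is the hockey-stick identity together with b (N(n) choose n) = N(n) choose n + 1.

open import Defs
open import Data.Empty using (⊥-elim)
open import Data.Fin.Base using (Fin; zero; suc; toℕ; fromℕ<)
open import Data.Fin.Properties using (+↔⊎; toℕ<n; toℕ-fromℕ<; toℕ-injective)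
open import Data.Integer.Base as ℤ using (ℤ; 0ℤ) renaming (+_ to pos)
import Data.Integer.Properties as ℤ
open import Algebra.Properties.AbelianGroup ℤ.+-0-abelianGroup using (∙-cancelˡ)
import Data.Integer.Tactic.RingSolver as ℤ-Solver
open import Data.List.Base using (List; []; _∷_; filter; foldr; length; map)
open import Data.List.Membership.Propositional using (_∈_; lose; find)
open import Data.List.Membership.Propositional.Properties using (∈-filter⁺; ∈-filter⁻; ∈-map⁺; ∈-map⁻; foldr-selective)
open import Data.List.Properties using (filter-reject; ∷-injectiveˡ; ∷-injectiveʳ)
open import Data.List.Relation.Binary.Permutation.Propositional using (_↭_; ↭-refl; ↭-reflexive; ↭-sym; ↭-trans; prep; swap)
open import Data.List.Relation.Binary.Permutation.Propositional.Properties using (∈-resp-↭; drop-∷; ↭-length)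
open import Data.List.Relation.Unary.Any using (Any; here; there)
open import Data.List.Relation.Unary.Linked as Linked using (Linked; []; [-]; _∷_)
open import Data.Nat.Base using (ℕ; zero; suc; _+_; _⊔_; _<_; z≤n; s≤s; _≤_; _*_; _∸_)
open import Data.Nat.Combinatorics using (_C_; nC1≡n; nCk+nC[k+1]≡[n+1]C[k+1])
import Data.Nat.Properties as ℕ
import Data.Nat.Tactic.RingSolver as ℕ-Solver
open import Data.Product using (Σ; ∃; _×_; _,_; proj₁; proj₂)
open import Data.Sum.Base using (_⊎_; inj₁; inj₂)
open import Data.Sum.Function.Propositional using (_⊎-↔_)
open import Data.Unit.Base using (⊤; tt)
open import Function.Base using (_∘_)
open import Function.Bundles using (Bijection; _↔_; mk↔ₛ′)
open import Function.Construct.Composition using (bijection)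
open import Function.Properties.Inverse using (↔-sym; ↔-trans; Inverse⇒Bijection)
open import Relation.Binary.Definitions using (tri<; tri≈; tri>)
open import Relation.Binary.PropositionalEquality using (_≡_; refl; sym; trans; cong; cong₂; subst; subst₂; setoid; module ≡-Reasoning)
open import Relation.Nullary using (¬_; yes; no)

-- Binomial coefficients

nCk-absorb : ∀ n k → suc k * (suc n C suc k) ≡ suc n * (n C k)
nCk-absorb zero    zero    = refl
nCk-absorb zero    (suc k) = ℕ.*-zeroʳ (suc (suc k))
nCk-absorb (suc n) zero    = begin
  1 * (suc (suc n) C 1)  ≡⟨ ℕ.*-identityˡ _ ⟩
  suc (suc n) C 1        ≡⟨ nC1≡n (suc (suc n)) ⟩
  suc (suc n)            ≡⟨ ℕ.*-identityʳ _ ⟨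
  suc (suc n) * 1        ∎
  where open ≡-Reasoning
nCk-absorb (suc n) (suc k) = begin
  suc (suc k) * (suc (suc n) C suc (suc k))
    ≡⟨ cong (suc (suc k) *_) (nCk+nC[k+1]≡[n+1]C[k+1] (suc n) (suc k)) ⟨
  suc (suc k) * (x + (suc n C suc (suc k)))
    ≡⟨ ℕ.*-distribˡ-+ (suc (suc k)) x _ ⟩
  (x + suc k * x) + suc (suc k) * (suc n C suc (suc k))
    ≡⟨ cong₂ (λ u v → (x + u) + v) (nCk-absorb n k) (nCk-absorb n (suc k)) ⟩
  (x + suc n * (n C k)) + suc n * (n C suc k)
    ≡⟨ ℕ.+-assoc x _ _ ⟩
  x + (suc n * (n C k) + suc n * (n C suc k))
    ≡⟨ cong (x +_) (ℕ.*-distribˡ-+ (suc n) (n C k) _) ⟨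
  x + suc n * ((n C k) + (n C suc k))
    ≡⟨ cong (λ u → x + suc n * u) (nCk+nC[k+1]≡[n+1]C[k+1] n k) ⟩
  suc (suc n) * x ∎
  where
  open ≡-Reasoning
  x = suc n C suc k

-- Pascal's rule splits the left side of the absorption identity, and the summand `suc k * x` is
-- then common to both sides.
[1+k]*[k+j]C[1+k] : ∀ k j → suc k * ((k + j) C suc k) ≡ j * ((k + j) C k)
[1+k]*[k+j]C[1+k] k j = ℕ.+-cancelˡ-≡ (suc k * x) _ _ (begin
  suc k * x + suc k * (n C suc k)  ≡⟨ ℕ.*-distribˡ-+ (suc k) x _ ⟨
  suc k * (x + (n C suc k))        ≡⟨ cong (suc k *_) (nCk+nC[k+1]≡[n+1]C[k+1] n k) ⟩
  suc k * (suc n C suc k)          ≡⟨ nCk-absorb n k ⟩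
  (suc k + j) * x                  ≡⟨ ℕ.*-distribʳ-+ x (suc k) j ⟩
  suc k * x + j * x                ∎)
  where
  open ≡-Reasoning
  n = k + j
  x = n C k

-- `N` exceeds `n` by `b * suc n`, so the ratio of the two binomials, `(N - n) / suc n`, is exactly
-- `b`.
b*NCn≡NC[1+n] : ∀ b n → b * ((n + b * suc n) C n) ≡ (n + b * suc n) C suc n
b*NCn≡NC[1+n] b n = ℕ.*-cancelˡ-≡ _ _ (suc n) (begin
  suc n * (b * x)        ≡⟨ ℕ.*-assoc (suc n) b x ⟨
  suc n * b * x          ≡⟨ cong (_* x) (ℕ.*-comm (suc n) b) ⟩
  b * suc n * x          ≡⟨ [1+k]*[k+j]C[1+k] n (b * suc n) ⟨
  suc n * (N C suc n)    ∎)
  where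
  open ≡-Reasoning
  N = n + b * suc n
  x = N C n

sumTo : (ℕ → ℕ) → ℕ → ℕ
sumTo f zero    = 0
sumTo f (suc n) = f 0 + sumTo (f ∘ suc) n

sumTo-cong : ∀ {f g} → (∀ k → f k ≡ g k) → ∀ n → sumTo f n ≡ sumTo g n
sumTo-cong f≗g zero    = refl
sumTo-cong f≗g (suc n) = cong₂ _+_ (f≗g 0) (sumTo-cong (f≗g ∘ suc) n)

-- Truncated subtraction sends each of the first `b` indices to 0.
sumTo-∸ : ∀ (f : ℕ → ℕ) b n → sumTo (λ k → f (k ∸ b)) (b + n) ≡ b * f 0 + sumTo f n
sumTo-∸ f zero    n = refl
sumTo-∸ f (suc b) n = begin
  f 0 + sumTo (λ k → f (k ∸ b)) (b + n)  ≡⟨ cong (f 0 +_) (sumTo-∸ f b n) ⟩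
  f 0 + (b * f 0 + sumTo f n)            ≡⟨ ℕ.+-assoc (f 0) _ _ ⟨
  f 0 + b * f 0 + sumTo f n              ∎
  where open ≡-Reasoning

-- Pascal's rule merges the leading binomial with the `j = 0` term into `suc N C suc n`, leaving the
-- same identity with `N` raised and `t` lowered by one.
hockeyStick : ∀ N n t → (N C suc n) + sumTo (λ j → (N + j) C n) t ≡ (N + t) C suc n
hockeyStick N n zero    = trans (ℕ.+-identityʳ _) (cong (_C suc n) (sym (ℕ.+-identityʳ N)))
hockeyStick N n (suc t) = begin
  (N C suc n) + (((N + 0) C n) + sumTo (λ j → (N + suc j) C n) t)
    ≡⟨ cong₂ (λ u v → (N C suc n) + ((u C n) + v)) (ℕ.+-identityʳ N)
         (sumTo-cong (λ j → cong (_C n) (ℕ.+-suc N j)) t) ⟩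
  (N C suc n) + ((N C n) + sumTo (λ j → (suc N + j) C n) t)
    ≡⟨ ℕ.+-assoc (N C suc n) _ _ ⟨
  (N C suc n) + (N C n) + sumTo (λ j → (suc N + j) C n) t
    ≡⟨ cong (_+ sumTo (λ j → (suc N + j) C n) t) (trans (ℕ.+-comm (N C suc n) _) (nCk+nC[k+1]≡[n+1]C[k+1] N n)) ⟩
  (suc N C suc n) + sumTo (λ j → (suc N + j) C n) t
    ≡⟨ hockeyStick (suc N) n t ⟩
  (suc N + t) C suc n
    ≡⟨ cong (_C suc n) (ℕ.+-suc N t) ⟨
  (N + suc t) C suc n ∎
  where open ≡-Reasoning

-- Codes of pyramids

Σ-Fin↔ : ∀ n (f : ℕ → ℕ) {P : Fin n → Set} → (∀ k → P k ↔ Fin (f (toℕ k))) → Σ (Fin n) P ↔ Fin (sumTo f n)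
Σ-Fin↔ zero    f P↔ = mk↔ₛ′ (λ ()) (λ ()) (λ ()) (λ ())
Σ-Fin↔ (suc n) f {P} P↔ =
  ↔-trans split (↔-trans (P↔ zero ⊎-↔ Σ-Fin↔ n (f ∘ suc) (P↔ ∘ suc)) (↔-sym +↔⊎))
  where
  split : Σ (Fin (suc n)) P ↔ (P zero ⊎ Σ (Fin n) (P ∘ suc))
  split = mk↔ₛ′
    (λ { (zero , p) → inj₁ p ; (suc k , p) → inj₂ (k , p) })
    (λ { (inj₁ p) → zero , p ; (inj₂ (k , p)) → suc k , p })
    (λ { (inj₁ p) → refl ; (inj₂ (k , p)) → refl })
    (λ { (zero , p) → refl ; (suc k , p) → refl })

module _ (b : ℕ) where

  -- d is the distance from the piece dropped last to the rightmost piece so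
  -- far; the next piece starts b − k to the right of the rightmost one.
  Code : ℕ → ℕ → Set
  Code d zero    = ⊤
  Code d (suc n) = Σ (Fin (b + suc (b + d))) λ k → Code (toℕ k ∸ b) n

  sum-codes : ∀ n d → sumTo (λ k → (n + b * suc n + (k ∸ b)) C n) (b + suc (b + d))
                    ≡ (suc n + b * suc (suc n) + d) C suc n
  sum-codes n d = begin
    sumTo (λ k → (N + (k ∸ b)) C n) (b + suc (b + d))
      ≡⟨ sumTo-∸ (λ j → (N + j) C n) b (suc (b + d)) ⟩
    b * ((N + 0) C n) + S
      ≡⟨ cong (λ u → b * (u C n) + S) (ℕ.+-identityʳ N) ⟩
    b * (N C n) + S
      -- The `b` truncated terms supply exactly the leading binomial of the hockey stick.
      ≡⟨ cong (_+ S) (b*NCn≡NC[1+n] b n) ⟩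
    (N C suc n) + S
      ≡⟨ hockeyStick N n (suc (b + d)) ⟩
    (N + suc (b + d)) C suc n
      ≡⟨ cong (_C suc n) (arith b n d) ⟩
    (suc n + b * suc (suc n) + d) C suc n ∎
    where
    open ≡-Reasoning
    N = n + b * suc n
    S = sumTo (λ j → (N + j) C n) (suc (b + d))
    arith : ∀ b n d → n + b * suc n + suc (b + d) ≡ suc n + b * suc (suc n) + d
    arith = ℕ-Solver.solve-∀

  Code↔Fin : ∀ n d → Code d n ↔ Fin ((n + b * suc n + d) C n)
  Code↔Fin zero    d = mk↔ₛ′ (λ _ → zero) (λ _ → tt) (λ { zero → refl }) (λ _ → refl)
  Code↔Fin (suc n) d = subst (λ N → Code d (suc n) ↔ Fin N) (sum-codes n d)
    (Σ-Fin↔ _ (λ k → (n + b * suc n + (k ∸ b)) C n) (λ k → Code↔Fin n (toℕ k ∸ b)))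

-- Heaps

module _ {a : ℕ} where

  concurrent-sym : ∀ {s t} → Concurrent a s t → Concurrent a t s
  concurrent-sym (x , x∈s , x∈t) = x , x∈t , x∈s

  restLevel-upper : ∀ {s p c} → p ∈ c → Concurrent a s (position p) → level p < restLevel a s c
  restLevel-upper {s} p∈c s∥p = ≤-foldr (∈-map⁺ _ (∈-filter⁺ (concurrent? a s ∘ position) p∈c s∥p))
    where
    ≤-foldr : ∀ {n ns} → n ∈ ns → n ≤ foldr _⊔_ 0 ns
    ≤-foldr (here refl)           = ℕ.m≤m⊔n _ _
    ≤-foldr {ns = m ∷ _} (there n∈ns) = ℕ.≤-trans (≤-foldr n∈ns) (ℕ.m≤n⊔m m _)

  restLevel-selective : ∀ s c → restLevel a s c ≡ 0 ⊎
    ∃ λ p → p ∈ c × Concurrent a s (position p) × restLevel a s c ≡ suc (level p)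
  restLevel-selective s c with foldr-selective ℕ.⊔-sel 0 (map (suc ∘ level) (filter (concurrent? a s ∘ position) c))
  ... | inj₁ ≡0 = inj₁ ≡0
  ... | inj₂ ∈map with ∈-map⁻ (suc ∘ level) ∈map
  ...   | p , p∈filter , ≡level with ∈-filter⁻ (concurrent? a s ∘ position) p∈filter
  ...     | p∈c , s∥p = inj₂ (p , p∈c , s∥p , ≡level)

  restLevel-least : ∀ s c {n} → (∀ {p} → p ∈ c → Concurrent a s (position p) → level p < n) → restLevel a s c ≤ n
  restLevel-least s c bound with restLevel-selective s c
  ... | inj₁ ≡0                 = subst (_≤ _) (sym ≡0) z≤n
  ... | inj₂ (p , p∈c , s∥p , ≡level) = subst (_≤ _) (sym ≡level) (bound p∈c s∥p)

  restLevel-mono : ∀ s {c c′} → (∀ {p} → p ∈ c → p ∈ c′) → restLevel a s c ≤ restLevel a s c′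
  restLevel-mono s c⊆c′ = restLevel-least s _ (restLevel-upper ∘ c⊆c′)

  restLevel-↭ : ∀ s {c c′} → c ↭ c′ → restLevel a s c ≡ restLevel a s c′
  restLevel-↭ s c↭c′ = ℕ.≤-antisym (restLevel-mono s (∈-resp-↭ c↭c′)) (restLevel-mono s (∈-resp-↭ (↭-sym c↭c′)))

  restLevel-skip : ∀ {s p c} → ¬ Concurrent a s (position p) → restLevel a s (p ∷ c) ≡ restLevel a s c
  restLevel-skip {s} ∦ = cong (foldr _⊔_ 0 ∘ map (suc ∘ level)) (filter-reject (concurrent? a s ∘ position) ∦)

  dropPiece-↭ : ∀ {s c c′} → c ↭ c′ → dropPiece a s c ↭ dropPiece a s c′
  dropPiece-↭ {s} {c} {c′} c↭c′ =
    subst (λ l → dropPiece a s c ↭ (s at l) ∷ c′) (restLevel-↭ s c↭c′) (prep _ c↭c′)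

  dropPiece-comm : ∀ {s t c} → ¬ Concurrent a s t →
                   dropPiece a s (dropPiece a t c) ↭ dropPiece a t (dropPiece a s c)
  dropPiece-comm {s} {t} {c} ∦ = ↭-trans
    (↭-reflexive (cong (λ l → (s at l) ∷ dropPiece a t c) (restLevel-skip ∦)))
    (↭-trans (swap _ _ ↭-refl)
      (↭-reflexive (cong (λ l → (t at l) ∷ dropPiece a s c) (sym (restLevel-skip (∦ ∘ concurrent-sym))))))

  ∈-configuration⁺ : ∀ {s w} → s ∈ w → ∃ λ l → (s at l) ∈ configuration a w
  ∈-configuration⁺ (here refl) = _ , here refl
  ∈-configuration⁺ (there s∈w) with ∈-configuration⁺ s∈w
  ... | l , p∈c = l , there p∈c

  ∈-configuration⁻ : ∀ {p} w → p ∈ configuration a w → position p ∈ w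
  ∈-configuration⁻ (_ ∷ w) (here refl) = here refl
  ∈-configuration⁻ (_ ∷ w) (there p∈c) = there (∈-configuration⁻ w p∈c)

  configuration-grounded : ∀ s w → ∃ λ t → (t at 0) ∈ configuration a (s ∷ w)
  configuration-grounded s []      = s , here refl
  configuration-grounded s (t ∷ w) with configuration-grounded t w
  ... | u , u∈ = u , there u∈

  length-configuration : ∀ w → length (configuration a w) ≡ length w
  length-configuration []      = refl
  length-configuration (_ ∷ w) = cong suc (length-configuration w)

-- Normal dropping orders

<-or-≥ : ∀ i j → i ℤ.< j ⊎ j ℤ.≤ i
<-or-≥ i j with i ℤ.<? j
... | yes i<j = inj₁ i<j
... | no  i≮j = inj₂ (ℤ.≮⇒≥ i≮j)

module _ (b : ℕ) where

  private
    a = suc b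

  -- A piece lying entirely to the left of the one dropped just before it
  -- should have been dropped earlier.
  Normal : List ℤ → Set
  Normal = Linked λ x y → y ℤ.< x ℤ.+ pos a

  i<i+a : ∀ i → i ℤ.< i ℤ.+ pos a
  i<i+a i = subst (ℤ._< i ℤ.+ pos a) (ℤ.+-identityʳ i) (ℤ.+-monoʳ-< i (ℤ.+<+ (s≤s z≤n)))

  concurrent-refl : ∀ s → Concurrent a s s
  concurrent-refl s = overlap⇒concurrent (i<i+a s , i<i+a s)

  -- The piece `x`, dropped last, sinks past the pieces entirely to its right and stops at the first
  -- other one. The pieces it passes are not concurrent with it, so the heap is unchanged.
  insert : ℤ → List ℤ → List ℤ
  insert x [] = x ∷ []
  insert x (y ∷ w) with y ℤ.<? x ℤ.+ pos a
  ... | yes _ = x ∷ y ∷ w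
  ... | no  _ = y ∷ insert x w

  insert-normal : ∀ {x w} → Normal w → Normal (insert x w)
  insert-normal {w = []} _ = [-]
  insert-normal {x} {y ∷ w} n with y ℤ.<? x ℤ.+ pos a
  ... | yes y<x+a = y<x+a ∷ n
  ... | no  y≮x+a = after n (insert-normal (Linked.tail n))
    where
    x<y+a : x ℤ.< y ℤ.+ pos a
    x<y+a = ℤ.<-trans (ℤ.<-≤-trans (i<i+a x) (ℤ.≮⇒≥ y≮x+a)) (i<i+a y)
    -- The new neighbour of `y` is either `x`, which starts to the left of `y`, or the old
    -- neighbour.
    after : ∀ {w} → Normal (y ∷ w) → Normal (insert x w) → Normal (y ∷ insert x w)
    after {[]} _ n′ = x<y+a ∷ n′
    after {z ∷ w} n n′ with z ℤ.<? x ℤ.+ pos a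
    ... | yes _ = x<y+a ∷ n′
    ... | no  _ = Linked.head n ∷ n′

  insert-cases : ∀ x y w → insert x (y ∷ w) ≡ x ∷ y ∷ w ⊎
                 (x ℤ.+ pos a ℤ.≤ y × insert x (y ∷ w) ≡ y ∷ insert x w)
  insert-cases x y w with y ℤ.<? x ℤ.+ pos a
  ... | yes _     = inj₁ refl
  ... | no  y≮x+a = inj₂ (ℤ.≮⇒≥ y≮x+a , refl)

  insert-configuration : ∀ x w → configuration a (insert x w) ↭ configuration a (x ∷ w)
  insert-configuration x [] = ↭-refl
  insert-configuration x (y ∷ w) with insert-cases x y w
  ... | inj₁ eq = ↭-reflexive (cong (configuration a) eq)
  ... | inj₂ (x+a≤y , eq) = ↭-trans (↭-reflexive (cong (configuration a) eq))
      (↭-trans (dropPiece-↭ (insert-configuration x w))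
               (dropPiece-comm (λ y∥x → ℤ.<⇒≱ (proj₁ (concurrent⇒overlap y∥x)) x+a≤y)))

  normalise : List ℤ → List ℤ
  normalise = foldr insert []

  normalise-normal : ∀ w → Normal (normalise w)
  normalise-normal []      = []
  normalise-normal (x ∷ w) = insert-normal (normalise-normal w)

  normalise-configuration : ∀ w → configuration a (normalise w) ↭ configuration a w
  normalise-configuration []      = ↭-refl
  normalise-configuration (x ∷ w) = ↭-trans (insert-configuration x (normalise w)) (dropPiece-↭ (normalise-configuration w))

  -- Recovers the level of the last piece from the whole configuration, in a form invariant under
  -- `↭`.
  restLevel-dropPiece : ∀ s c → restLevel a s (dropPiece a s c) ≡ suc (restLevel a s c)
  restLevel-dropPiece s c = ℕ.≤-antisym
    (restLevel-least s (dropPiece a s c) λ { (here refl) _ → ℕ.≤-refl ; (there p∈c) s∥p → ℕ.m<n⇒m<1+n (restLevel-upper p∈c s∥p) })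
    (restLevel-upper (here refl) (concurrent-refl s))

  -- In a normal order a step down the list raises the position by less than a,
  -- so the list cannot pass from the left of y to y without meeting a piece
  -- concurrent with y.
  normal-covers : ∀ {x y l w} → Normal (x ∷ w) → x ℤ.+ pos a ℤ.≤ y →
                  (y at l) ∈ configuration a w → suc l < restLevel a y (configuration a w)
  normal-covers (z<x+a ∷ n) x+a≤y (here refl) = ⊥-elim (ℤ.<⇒≱ z<x+a x+a≤y)
  normal-covers {y = y} {w = z ∷ w} (z<x+a ∷ n) x+a≤y (there y∈) with <-or-≥ y (z ℤ.+ pos a)
  ... | inj₂ z+a≤y = ℕ.≤-trans (normal-covers n z+a≤y y∈) (restLevel-mono y {configuration a w} there)
  ... | inj₁ y<z+a = ℕ.≤-<-trans (restLevel-upper y∈ (concurrent-sym y∥z)) (restLevel-upper (here refl) y∥z)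
    where
    y∥z : Concurrent a y z
    y∥z = overlap⇒concurrent (y<z+a , ℤ.<-trans (ℤ.<-≤-trans z<x+a x+a≤y) (i<i+a y))

  headPiece∈tail : ∀ {x y} u v → ¬ x ≡ y → configuration a (x ∷ u) ↭ configuration a (y ∷ v) →
                   (y at restLevel a y (configuration a v)) ∈ configuration a u
  headPiece∈tail u v x≢y u↭v with ∈-resp-↭ (↭-sym u↭v) (here refl)
  ... | here eq = ⊥-elim (x≢y (sym (cong position eq)))
  ... | there p = p

  -- If `y` lies entirely to the right of `x`, then `normal-covers` finds a piece above the `y`
  -- piece and concurrent with it, although the second order drops that piece last. If the two are
  -- concurrent, each would lie above the other, being last in its own order.
  head-≯ : ∀ {x y} u v → Normal (x ∷ u) → configuration a (x ∷ u) ↭ configuration a (y ∷ v) → ¬ (x ℤ.< y)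
  head-≯ {x} {y} u v n u↭v x<y with <-or-≥ y (x ℤ.+ pos a)
  ... | inj₂ x+a≤y = ℕ.<-irrefl
      (trans (sym (restLevel-dropPiece y (configuration a v))) (sym (restLevel-↭ y u↭v)))
      (ℕ.<-≤-trans (normal-covers n x+a≤y (headPiece∈tail u v (ℤ.<⇒≢ x<y) u↭v)) (restLevel-mono y {configuration a u} there))
  ... | inj₁ y<x+a = ℕ.<-asym
      (restLevel-upper (headPiece∈tail u v (ℤ.<⇒≢ x<y) u↭v) x∥y)
      (restLevel-upper (headPiece∈tail v u (ℤ.<⇒≢ x<y ∘ sym) (↭-sym u↭v)) (concurrent-sym x∥y))
    where
    x∥y : Concurrent a x y
    x∥y = overlap⇒concurrent (ℤ.<-trans x<y (i<i+a y) , y<x+a)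

  -- By `head-≯` both ways the heads share a position. They also share a rest level, so the same
  -- placed piece can be cancelled from both configurations.
  normal-unique : ∀ {u v} → Normal u → Normal v → configuration a u ↭ configuration a v → u ≡ v
  normal-unique {[]}    {[]}    _  _  _   = refl
  normal-unique {[]}    {_ ∷ _} _  _  u↭v with () ← ↭-length u↭v
  normal-unique {_ ∷ _} {[]}    _  _  u↭v with () ← ↭-length u↭v
  normal-unique {x ∷ u} {y ∷ v} nu nv u↭v with ℤ.<-cmp x y
  ... | tri< x<y _ _ = ⊥-elim (head-≯ u v nu u↭v x<y)
  ... | tri> _ _ y<x = ⊥-elim (head-≯ v u nv (↭-sym u↭v) y<x)
  ... | tri≈ _ refl _ = cong (x ∷_) (normal-unique (Linked.tail nu) (Linked.tail nv)
      (drop-∷ (subst (λ l → configuration a (x ∷ u) ↭ (x at l) ∷ configuration a v) (sym same) u↭v)))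
    where
    same : restLevel a x (configuration a u) ≡ restLevel a x (configuration a v)
    same = ℕ.suc-injective (trans (sym (restLevel-dropPiece x (configuration a u)))
             (trans (restLevel-↭ x u↭v) (restLevel-dropPiece x (configuration a v))))

  -- Dropping orders of pyramids

  -- Being a pyramid, restated on the dropping order: a piece stays off the axis exactly when it
  -- meets an earlier one.
  data Supported : List ℤ → Set where
    base : Supported (0ℤ ∷ [])
    _∷_  : ∀ {x w} → Any (Concurrent a x) w → Supported w → Supported (x ∷ w)

  bottom-∈ : ∀ {w} → Supported w → (0ℤ at 0) ∈ configuration a w
  bottom-∈ base    = here refl
  bottom-∈ (_ ∷ s) = there (bottom-∈ s)

  bottom-unique : ∀ {w p} → Supported w → p ∈ configuration a w → level p ≡ 0 → (0ℤ at 0) ≡ p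
  bottom-unique base    (here refl) _  = refl
  bottom-unique (_ ∷ s) (there p∈) ≡0 = bottom-unique s p∈ ≡0
  bottom-unique (x∥w ∷ s) (here refl) ≡0 with find x∥w
  ... | y , y∈w , x∥y with ∈-configuration⁺ y∈w
  ...   | l , p∈ with () ← subst (l <_) ≡0 (restLevel-upper p∈ x∥y)

  supported : ∀ {w x} → (∀ {p} → p ∈ configuration a (x ∷ w) → level p ≡ 0 → (0ℤ at 0) ≡ p) → Supported (x ∷ w)
  supported {[]} unique with refl ← unique (here refl) refl = base
  supported {y ∷ w} {x} unique with restLevel-selective {a} x (configuration a (y ∷ w))
  ... | inj₂ (p , p∈ , x∥p , _) = lose (∈-configuration⁻ (y ∷ w) p∈) x∥p ∷ supported (unique ∘ there)
  -- If `x` rested on the axis it would be the piece at 0. The earlier pieces already include one on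
  -- the axis, which by uniqueness is at 0 too, so `x` would have landed on it.
  ... | inj₁ ≡0 with cong position (unique (here refl) ≡0) | configuration-grounded {a} y w
  ...   | refl | t , t∈ with refl ← unique (there t∈) refl
        with () ← subst (0 <_) ≡0 (restLevel-upper t∈ (concurrent-refl 0ℤ))

  -- Reachable orders

  -- The default 0 is harmless: the orders of interest contain the piece at 0.
  top : List ℤ → ℤ
  top = foldr ℤ._⊔_ 0ℤ

  ∈⇒≤top : ∀ {z w} → z ∈ w → z ℤ.≤ top w
  ∈⇒≤top {w = x ∷ w} (here refl) = ℤ.i≤i⊔j x (top w)
  ∈⇒≤top {w = x ∷ w} (there z∈w) = ℤ.≤-trans (∈⇒≤top z∈w) (ℤ.i≤j⊔i x (top w))

  top-∈ : ∀ {w} → 0ℤ ∈ w → top w ∈ w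
  top-∈ {w} 0∈w with foldr-selective ℤ.⊔-sel 0ℤ w
  ... | inj₁ ≡0 = subst (_∈ w) (sym ≡0) 0∈w
  ... | inj₂ ∈w = ∈w

  place : List ℤ → ℕ → ℤ
  place w k = (top w ℤ.+ pos b) ℤ.- pos k

  -- For `k ≤ b` the new piece is itself rightmost, at distance 0. Otherwise `top w` stays
  -- rightmost, `k ∸ b` away.
  place-⊔-top : ∀ w k → place w k ℤ.+ pos (k ∸ b) ≡ place w k ℤ.⊔ top w
  place-⊔-top w k with ℕ.≤-total k b
  ... | inj₁ k≤b = begin
    place w k ℤ.+ pos (k ∸ b)  ≡⟨ cong (λ j → place w k ℤ.+ pos j) (ℕ.m≤n⇒m∸n≡0 k≤b) ⟩
    place w k ℤ.+ 0ℤ           ≡⟨ ℤ.+-identityʳ (place w k) ⟩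
    place w k                  ≡⟨ ℤ.i≥j⇒i⊔j≡i T≤place ⟨
    place w k ℤ.⊔ top w        ∎
    where
    open ≡-Reasoning
    T≤place : top w ℤ.≤ place w k
    T≤place = subst (top w ℤ.≤_) (sym (ℤ.+-assoc (top w) (pos b) (ℤ.- pos k)))
      (subst (ℤ._≤ top w ℤ.+ (pos b ℤ.- pos k)) (ℤ.+-identityʳ (top w))
        (ℤ.+-monoʳ-≤ (top w) (ℤ.i≤j⇒0≤j-i (ℤ.+≤+ k≤b))))
  ... | inj₂ b≤k = trans climb (sym (ℤ.i≤j⇒i⊔j≡j (subst (place w k ℤ.≤_) climb (ℤ.i≤i+j (place w k) (pos (k ∸ b))))))
    where
    ring : ∀ T β j → ((T ℤ.+ β) ℤ.+ ℤ.- (j ℤ.+ β)) ℤ.+ j ≡ T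
    ring = ℤ-Solver.solve-∀
    climb : place w k ℤ.+ pos (k ∸ b) ≡ top w
    climb = trans (cong (λ j → ((top w ℤ.+ pos b) ℤ.- pos j) ℤ.+ pos (k ∸ b)) (sym (ℕ.m∸n+n≡m b≤k)))
                  (ring (top w) (pos b) (pos (k ∸ b)))

  place-injective : ∀ w {j k} → place w j ≡ place w k → j ≡ k
  place-injective w eq = ℤ.+-injective (ℤ.neg-injective (∙-cancelˡ (top w ℤ.+ pos b) _ _ eq))

  -- The orders described by codes: the first index counts the pieces after the bottom one, the
  -- second is the distance tracked by `Code`.
  data Reachable : ℕ → ℕ → List ℤ → Set where
    base : Reachable 0 0 (0ℤ ∷ [])
    step : ∀ {n d w} → Reachable n d w → (k : Fin (b + suc (b + d))) →
           Reachable (suc n) (toℕ k ∸ b) (place w (toℕ k) ∷ w)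

  reachable-gap : ∀ {n d x w} → Reachable n d (x ∷ w) → x ℤ.+ pos d ≡ top (x ∷ w)
  reachable-gap base               = refl
  reachable-gap (step {w = w} r k) = place-⊔-top w (toℕ k)

  reachable-length : ∀ {n d w} → Reachable n d w → length w ≡ suc n
  reachable-length base       = refl
  reachable-length (step r k) = cong suc (reachable-length r)

  reachable-normal : ∀ {n d w} → Reachable n d w → Normal w
  reachable-normal base = [-]
  reachable-normal (step {w = []} () k)
  reachable-normal (step {d = d} {w = y ∷ w} r k) = y<place+a ∷ reachable-normal r
    where
    K = b + suc (b + d)
    -- Here `e` stands for 1. Since `y + d` is the top, `place + a` equals `y + (K - k)`, so
    -- normality amounts to `k < K`.
    ring : ∀ y δ β κ e → (((y ℤ.+ δ) ℤ.+ β) ℤ.+ ℤ.- κ) ℤ.+ (e ℤ.+ β) ≡ y ℤ.+ ((β ℤ.+ (e ℤ.+ (β ℤ.+ δ))) ℤ.+ ℤ.- κ)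
    ring = ℤ-Solver.solve-∀
    y<place+a : y ℤ.< place (y ∷ w) (toℕ k) ℤ.+ pos a
    y<place+a = subst (λ T → y ℤ.< ((T ℤ.+ pos b) ℤ.- pos (toℕ k)) ℤ.+ pos a) (reachable-gap r)
      (subst (y ℤ.<_) (sym (ring y (pos d) (pos b) (pos (toℕ k)) (pos 1)))
        (subst (ℤ._< y ℤ.+ (pos K ℤ.- pos (toℕ k))) (trans (cong (λ j → y ℤ.+ j) (ℤ.+-inverseʳ (pos (toℕ k)))) (ℤ.+-identityʳ y))
          (ℤ.+-monoʳ-< y (ℤ.+-monoˡ-< (ℤ.- pos (toℕ k)) (ℤ.+<+ (toℕ<n k))))))

  -- Pieces entirely to the left of `x` can be skipped without losing normality. The first other
  -- piece starts before `x + a`, hence meets `x`; the piece `z` ensures that there is one.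
  normal-concurrent : ∀ {x z w} → Normal (x ∷ w) → z ∈ w → x ℤ.< z ℤ.+ pos a → Any (Concurrent a x) w
  normal-concurrent {x} {w = y ∷ w} (y<x+a ∷ n) z∈ x<z+a with <-or-≥ x (y ℤ.+ pos a) | z∈
  ... | inj₁ x<y+a | _          = here (overlap⇒concurrent (x<y+a , y<x+a))
  ... | inj₂ y+a≤x | here refl  = ⊥-elim (ℤ.<⇒≱ x<z+a y+a≤x)
  ... | inj₂ y+a≤x | there z∈w = there (normal-concurrent (skip n) z∈w x<z+a)
    where
    skip : ∀ {w} → Normal (y ∷ w) → Normal (x ∷ w)
    skip [-]         = [-]
    skip (z<y+a ∷ n) = ℤ.<-trans (ℤ.<-≤-trans z<y+a y+a≤x) (i<i+a x) ∷ n

  reachable-supported : ∀ {n d w} → Reachable n d w → Supported w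
  reachable-supported base = base
  reachable-supported (step {w = w} r k) =
    normal-concurrent (reachable-normal (step r k)) (top-∈ (∈-configuration⁻ w (bottom-∈ s))) place<top+a ∷ s
    where
    s = reachable-supported r
    place<top+a : place w (toℕ k) ℤ.< top w ℤ.+ pos a
    place<top+a = ℤ.≤-<-trans (ℤ.i-j≤i (top w ℤ.+ pos b) (pos (toℕ k))) (ℤ.+-monoʳ-< (top w) (ℤ.+<+ ℕ.≤-refl))

  -- The only candidate for `k` is `top w + b - x`. Concurrency with some earlier piece makes it
  -- nonnegative, and normality bounds it above.
  next : ∀ {n d x w} → Reachable n d w → Normal (x ∷ w) → Any (Concurrent a x) w →
         ∃ λ (k : Fin (b + suc (b + d))) → place w (toℕ k) ≡ x
  next {d = d} {x} {y ∷ w} r (y<x+a ∷ _) x∥w with find x∥w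
  ... | z , z∈ , x∥z = fromℕ< k<K , trans (cong (place (y ∷ w)) (toℕ-fromℕ< k<K)) place≡x
    where
    T = top (y ∷ w)
    i = (T ℤ.+ pos b) ℤ.- x
    ring : ∀ T β e → ℤ.- e ℤ.+ (T ℤ.+ (e ℤ.+ β)) ≡ T ℤ.+ β
    ring = ℤ-Solver.solve-∀
    x≤T+b : x ℤ.≤ T ℤ.+ pos b
    x≤T+b = subst (x ℤ.≤_) (ring T (pos b) (pos 1))
      (ℤ.i<j⇒i≤pred[j] (ℤ.<-≤-trans (proj₁ (concurrent⇒overlap x∥z)) (ℤ.+-monoˡ-≤ (pos a) (∈⇒≤top z∈))))
    k≡i : pos ℤ.∣ i ∣ ≡ i
    k≡i = ℤ.0≤i⇒+∣i∣≡i (ℤ.i≤j⇒0≤j-i x≤T+b)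
    ring₁ : ∀ x t → t ℤ.+ ℤ.- (t ℤ.+ ℤ.- x) ≡ x
    ring₁ = ℤ-Solver.solve-∀
    place≡x : place (y ∷ w) ℤ.∣ i ∣ ≡ x
    place≡x = trans (cong (λ j → (T ℤ.+ pos b) ℤ.- j) k≡i) (ring₁ x (T ℤ.+ pos b))
    ring₂ : ∀ y δ β x → y ℤ.+ ((δ ℤ.+ β) ℤ.+ ℤ.- x) ≡ ((y ℤ.+ δ) ℤ.+ β) ℤ.+ ℤ.- x
    ring₂ = ℤ-Solver.solve-∀
    ring₃ : ∀ δ β x e → (x ℤ.+ (e ℤ.+ β)) ℤ.+ ((δ ℤ.+ β) ℤ.+ ℤ.- x) ≡ β ℤ.+ (e ℤ.+ (β ℤ.+ δ))
    ring₃ = ℤ-Solver.solve-∀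
    i<K : i ℤ.< pos (b + suc (b + d))
    i<K = subst (λ t → (t ℤ.+ pos b) ℤ.- x ℤ.< pos (b + suc (b + d))) (reachable-gap r)
      (subst₂ ℤ._<_ (ring₂ y (pos d) (pos b) x) (ring₃ (pos d) (pos b) x (pos 1))
        (ℤ.+-monoˡ-< ((pos d ℤ.+ pos b) ℤ.- x) y<x+a))
    k<K : ℤ.∣ i ∣ < b + suc (b + d)
    k<K = ℤ.drop‿+<+ (subst (ℤ._< pos (b + suc (b + d))) (sym k≡i) i<K)

  reachable : ∀ {w n} → Normal w → Supported w → length w ≡ suc n → ∃ λ d → Reachable n d w
  reachable {n = zero} _ base _ = 0 , base
  reachable {_ ∷ []}    {zero} _ (() ∷ _) _
  reachable {_ ∷ _ ∷ _} {zero} _ _ ()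
  reachable {n = suc n} norm (x∥w ∷ s) len with reachable (Linked.tail norm) s (ℕ.suc-injective len)
  ... | d , r with next r norm x∥w
  ...   | k , refl = toℕ k ∸ b , step r k

  -- Decoding codes into dropping orders

  extend : ∀ n {d} → Code b d n → List ℤ → List ℤ
  extend zero    _       w = w
  extend (suc n) (k , c) w = extend n c (place w (toℕ k) ∷ w)

  extend-reachable : ∀ {m d w} → Reachable m d w → ∀ n (c : Code b d n) {N} → m + n ≡ N →
                     ∃ λ e → Reachable N e (extend n c w)
  extend-reachable {m} r zero c refl rewrite ℕ.+-identityʳ m = _ , r
  extend-reachable {m} r (suc n) (k , c) eq = extend-reachable (step r k) n c (trans (sym (ℕ.+-suc m n)) eq)

  -- The last placement of the reachable order is moved to the front of the code, repeatedly, until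
  -- only the bottom piece remains.
  extend-surjective : ∀ {m d w} → Reachable m d w → ∀ n (c : Code b d n) {N} → m + n ≡ N →
                      ∃ λ c′ → extend N {0} c′ (0ℤ ∷ []) ≡ extend n c w
  extend-surjective base n c refl = c , refl
  extend-surjective {suc m} (step r k) n c eq = extend-surjective r (suc n) (k , c) (trans (ℕ.+-suc m n) eq)

  -- Both sides put `n` pieces in front of their starting order, so removing those pieces recovers
  -- it.
  extend-cancel : ∀ n {d d′ w w′} (c : Code b d n) (c′ : Code b d′ n) → extend n c w ≡ extend n c′ w′ → w ≡ w′
  extend-cancel zero    _       _         eq = eq
  extend-cancel (suc n) (_ , c) (_ , c′) eq = ∷-injectiveʳ (extend-cancel n c c′ eq)

  extend-injective : ∀ n {d w} (c c′ : Code b d n) → extend n c w ≡ extend n c′ w → c ≡ c′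
  extend-injective zero _ _ _ = refl
  extend-injective (suc n) {w = w} (k , c) (k′ , c′) eq
    with refl ← toℕ-injective {i = k} {k′} (place-injective w (∷-injectiveˡ (extend-cancel n c c′ eq)))
    = cong (k ,_) (extend-injective n c c′ eq)

  -- Bijection between pyramids and codes

  module _ (n : ℕ) where

    word : Code b 0 n → List ℤ
    word c = extend n c (0ℤ ∷ [])

    word-reachable : ∀ c → ∃ λ d → Reachable n d (word c)
    word-reachable c = extend-reachable base n c refl

    word-pyramid : Code b 0 n → Pyramid a (suc n)
    word-pyramid c = record
      { heap      = word c
      ; isPyramid = (0ℤ at 0) , (bottom-∈ s , refl) , λ (p∈ , ≡0) → bottom-unique s p∈ ≡0
      ; bottom    = bottom-∈ s
      ; size      = trans (length-configuration (word c)) (reachable-length r)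
      }
      where
      r = proj₂ (word-reachable c)
      s = reachable-supported r

    word-injective : ∀ c c′ → configuration a (word c) ↭ configuration a (word c′) → c ≡ c′
    word-injective c c′ c↭c′ = extend-injective n c c′
      (normal-unique (reachable-normal (proj₂ (word-reachable c))) (reachable-normal (proj₂ (word-reachable c′))) c↭c′)

    module _ (p : Pyramid a (suc n)) where
      open Pyramid p

      private
        same : configuration a (normalise heap) ↭ configuration a heap
        same = normalise-configuration heap

        len : length (normalise heap) ≡ suc n
        len = trans (sym (length-configuration {a} (normalise heap))) (trans (↭-length same) size)

        supp : ∀ w → length w ≡ suc n → configuration a w ↭ configuration a heap → Supported w
        supp (x ∷ w) _ w↭ = supported λ p∈ ≡0 →
          trans (sym (unique (bottom , refl))) (unique (∈-resp-↭ w↭ p∈ , ≡0))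
          where
          unique = proj₂ (proj₂ isPyramid)

      word-surjective : ∃ λ c → configuration a heap ↭ configuration a (word c)
      word-surjective
        with d , r ← reachable (normalise-normal heap) (supp (normalise heap) len same) len
        -- Starting from the empty code, the whole normal order is turned into a code.
        with c , eq ← extend-surjective r 0 tt (ℕ.+-identityʳ n)
        = c , ↭-trans (↭-sym same) (↭-reflexive (cong (configuration a) (sym eq)))

    encode : Pyramid a (suc n) → Code b 0 n
    encode p = proj₁ (word-surjective p)

    encode-unique : ∀ p c → configuration a (Pyramid.heap p) ↭ configuration a (word c) → encode p ≡ c
    encode-unique p c p↭c = word-injective (encode p) c (↭-trans (↭-sym (proj₂ (word-surjective p))) p↭c)

    pyramids : Bijection (Pyramids a (suc n)) (setoid (Code b 0 n))
    pyramids = record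
      { to        = encode
      ; cong      = λ {p} {q} p≈q → encode-unique p (encode q) (↭-trans p≈q (proj₂ (word-surjective q)))
      ; bijective =
          (λ {p} {q} eq → ↭-trans (proj₂ (word-surjective p))
            (↭-trans (↭-reflexive (cong (configuration a ∘ word) eq)) (↭-sym (proj₂ (word-surjective q)))))
        , (λ c → word-pyramid c , λ {p} → encode-unique p c)
      }

theorem1 : (a m : ℕ) → 2 ≤ a → 1 ≤ m → Bijection (Pyramids a m) (setoid (Fin ((a * m ∸ 1) C (m ∸ 1))))
-- `suc b * suc n ∸ 1` computes to `n + b * suc n`; the removed summand 0 is the distance `d` of the
-- lone bottom piece.
theorem1 (suc b) (suc n) _ _ = subst (λ N → Bijection (Pyramids (suc b) (suc n)) (setoid (Fin (N C n))))
  (ℕ.+-identityʳ (n + b * suc n)) (bijection (pyramids b n) (Inverse⇒Bijection (Code↔Fin b n 0)))
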